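{- Let $p>3$ be a prime and let $a$ be a positive integer. Then $$\sum_{k=0}^{p^a-1}\binom{2k}{k}\left(\frac{1-(-1)^{(p-1)/2}p}{4}\right)^k\equiv p^a\pmod{p^{a+1}}.$$ -}

module Defs where

open import Data.Nat.Base as ℕ using (ℕ; zero; suc)
import Data.Nat.Divisibility as ℕ
import Data.Nat.DivMod as ℕ
import Data.Nat.Properties as ℕ
open import Data.Integer.Base using (ℤ; +_; 1ℤ; -1ℤ; _+_; _*_; _-_; -_; _^_)
open import Data.Integer.DivMod
  using (_/_; _/ℕ_; _%ℕ_; a≡a%ℕn+[a/ℕn]*n; n%ℕd<d; div-pos-is-/ℕ)
open import Data.Integer.Divisibility.Signed
  using (_∣_; divides; ∣⇒∣ᵤ; ∣m+n∣n⇒∣m)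
open import Data.Integer.Properties using (+-0-commutativeMonoid; +-identityˡ)
open import Data.Integer.Tactic.RingSolver using (solve-∀)
open import Relation.Binary.PropositionalEquality
  using (_≡_; refl; sym; trans; cong; subst; module ≡-Reasoning)

-- In ∑[ k < n ] f k the index k ranges over Fin n.
open import Algebra.Properties.CommutativeMonoid.Sum +-0-commutativeMonoid public
  using (sum-syntax)

infix 4 _≡_[mod_]

_≡_[mod_] : ℤ → ℤ → ℤ → Set
x ≡ y [mod m ] = m ∣ x - y

-- p* = (-1)^((p-1)/2) p.
signedPrime : ℕ → ℤ
signedPrime p = -1ℤ ^ ((p ℕ.∸ 1) ℕ./ 2) * + p

-- (1 - p*) / 4, as an integer.  The division _/_ rounds in general, but it
-- is exact for every odd p: see base-exact.
base : ℕ → ℤ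
base p = (1ℤ - signedPrime p) / + 4

private
  /-exact : ∀ n → + 4 ∣ n → (n / + 4) * + 4 ≡ n
  /-exact n 4∣n = begin
    (n / + 4) * + 4                  ≡⟨ cong (_* + 4) (div-pos-is-/ℕ n 4) ⟩
    (n /ℕ 4) * + 4                   ≡⟨ +-identityˡ _ ⟨
    + 0 + (n /ℕ 4) * + 4             ≡⟨ cong (λ r → + r + (n /ℕ 4) * + 4) r≡0 ⟨
    + (n %ℕ 4) + (n /ℕ 4) * + 4      ≡⟨ a≡a%ℕn+[a/ℕn]*n n 4 ⟨
    n                                ∎
    where
    open ≡-Reasoning
    4∣r : + 4 ∣ + (n %ℕ 4)
    4∣r = ∣m+n∣n⇒∣m (subst (+ 4 ∣_) (a≡a%ℕn+[a/ℕn]*n n 4) 4∣n)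
                    (divides (n /ℕ 4) refl)
    r≡0 : n %ℕ 4 ≡ 0
    r≡0 = trans (sym (ℕ.m<n⇒m%n≡m (n%ℕd<d n 4))) (ℕ.n∣m⇒m%n≡0 _ 4 (∣⇒∣ᵤ 4∣r))

  4∣1-p* : ∀ h → + 4 ∣ 1ℤ - -1ℤ ^ h * + (1 ℕ.+ h ℕ.* 2)
  4∣1-p* zero          = divides (+ 0) refl
  4∣1-p* (suc zero)    = divides (+ 1) refl
  4∣1-p* (suc (suc h)) with 4∣1-p* h
  ... | divides q eq = divides (q - s) (begin
    1ℤ - -1ℤ * (-1ℤ * s) * (+ 4 + m)  ≡⟨ step s m ⟩
    (1ℤ - s * m) - s * + 4            ≡⟨ cong (_- s * + 4) eq ⟩
    q * + 4 - s * + 4                 ≡⟨ factor q s ⟩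
    (q - s) * + 4                     ∎)
    where
    open ≡-Reasoning
    s = -1ℤ ^ h
    m = + (1 ℕ.+ h ℕ.* 2)
    step : ∀ s m → 1ℤ - -1ℤ * (-1ℤ * s) * (+ 4 + m) ≡ (1ℤ - s * m) - s * + 4
    step = solve-∀
    factor : ∀ q s → q * + 4 - s * + 4 ≡ (q - s) * + 4
    factor = solve-∀

base-exact : ∀ h → let p = 1 ℕ.+ h ℕ.* 2 in base p * + 4 ≡ 1ℤ - signedPrime p
base-exact h = /-exact _
  (subst (λ e → + 4 ∣ 1ℤ - -1ℤ ^ e * + (1 ℕ.+ h ℕ.* 2))
         (sym (ℕ.m*n/n≡m h 2)) (4∣1-p* h))

{-# OPTIONS --safe #-}

-- Put D = p*, y = -D, x = (1 - D)/4 and q = p^a.  Expanding (4x)^k = (1 + y)^k gives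
--   4^q ∑_{k<q} C(2k,k) x^k = 4 ∑_{j<q} A_j y^j,   A_j = ∑_{k<q} 4^(q-1-k) C(2k,k) C(k,j),
-- and the inner sums telescope:
--   (2j + 1) A_j = (2q - 1) C(2q-2,q-1) C(q-1,j) = q C(2q-1,q-1) C(q-1,j).
-- For j ≥ 1 we have 2j + 1 < p^j (this needs p > 3), so the denominator 2j + 1 costs
-- fewer than j factors p and A_j y^j ≡ 0 mod pq.  The remaining term is
-- A_0 = q C(2q-1,q-1) ≡ q mod pq, and the factor 4^q ≡ 4 mod p is cancelled.

module Submission where

open import Defs
open import Data.Fin.Base using (toℕ; inject₁; fromℕ)
open import Data.Fin.Properties using (toℕ-inject₁; toℕ-fromℕ)
open import Data.Nat.Base as ℕ using (ℕ; zero; suc; s≤s; z≤n; s<s⁻¹)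
open import Data.Nat.Combinatorics
  using (_C_; nCn≡1; nC1≡n; k>n⇒nCk≡0; nCk≡nC[n∸k]; nCk+nC[k+1]≡[n+1]C[k+1])
open import Data.Nat.Primality using (Prime; euclidsLemma; prime⇒nonZero; prime⇒irreducible)
import Data.Nat.Properties as ℕ
open import Data.Product.Base using (∃; _,_)
open import Data.Sum.Base using (inj₁; inj₂)
open import Relation.Binary.PropositionalEquality
  using (_≡_; _≢_; refl; sym; trans; cong; cong₂; subst; module ≡-Reasoning)
open import Relation.Nullary using (¬_; yes; no; contradiction)

module Naturals where

  open import Data.Nat.Base using (_+_; _*_; _^_; _<_; _>_)
  open import Data.Nat.DivMod using (_/_; _%_; m≡m%n+[m/n]*n; m%n<n)
  open import Data.Nat.Divisibility
  open import Data.Nat.Tactic.RingSolver using (solve-∀)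
  open ≡-Reasoning

  -- Identities for binomial and central binomial coefficients.

  absorption : ∀ n k → suc k * (suc n C suc k) ≡ suc n * (n C k)
  absorption n zero = begin
    1 * (suc n C 1)      ≡⟨ cong (1 *_) (nC1≡n (suc n)) ⟩
    1 * suc n            ≡⟨ ℕ.*-comm 1 (suc n) ⟩
    suc n * 1            ∎
  absorption zero (suc k) = begin
    suc (suc k) * (1 C suc (suc k))  ≡⟨ cong (suc (suc k) *_) (k>n⇒nCk≡0 {1} {suc (suc k)} (s≤s (s≤s z≤n))) ⟩
    suc (suc k) * 0                  ≡⟨ ℕ.*-zeroʳ (suc (suc k)) ⟩
    0                                ≡⟨ cong (1 *_) (k>n⇒nCk≡0 {0} {suc k} (s≤s z≤n)) ⟨
    1 * (0 C suc k)                  ∎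
  absorption (suc n) (suc k) = begin
    suc (suc k) * (suc (suc n) C suc (suc k))
      ≡⟨ cong (suc (suc k) *_) (nCk+nC[k+1]≡[n+1]C[k+1] (suc n) (suc k)) ⟨
    suc (suc k) * (X + (suc n C suc (suc k)))
      ≡⟨ split (suc k) X _ ⟩
    X + (suc k * X + suc (suc k) * (suc n C suc (suc k)))
      ≡⟨ cong (X +_) (cong₂ _+_ (absorption n k) (absorption n (suc k))) ⟩
    X + (suc n * (n C k) + suc n * (n C suc k))
      ≡⟨ cong (X +_) (ℕ.*-distribˡ-+ (suc n) (n C k) _) ⟨
    X + suc n * ((n C k) + (n C suc k))
      ≡⟨ cong (λ z → X + suc n * z) (nCk+nC[k+1]≡[n+1]C[k+1] n k) ⟩
    suc (suc n) * X ∎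
    where
    X = suc n C suc k
    split : ∀ k x z → (1 + k) * (x + z) ≡ x + (k * x + (1 + k) * z)
    split = solve-∀

  -- (n + 1 - k) C(n + 1, k) = (n + 1) C(n, k), with the subtraction moved over.
  lowering : ∀ n k → suc n * (n C k) + k * (suc n C k) ≡ suc n * (suc n C k)
  lowering n zero    = ℕ.+-identityʳ _
  lowering n (suc k) = begin
    suc n * (n C suc k) + suc k * (suc n C suc k)  ≡⟨ cong (suc n * (n C suc k) +_) (absorption n k) ⟩
    suc n * (n C suc k) + suc n * (n C k)          ≡⟨ ℕ.+-comm (suc n * (n C suc k)) _ ⟩
    suc n * (n C k) + suc n * (n C suc k)          ≡⟨ ℕ.*-distribˡ-+ (suc n) (n C k) _ ⟨
    suc n * ((n C k) + (n C suc k))                ≡⟨ cong (suc n *_) (nCk+nC[k+1]≡[n+1]C[k+1] n k) ⟩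
    suc n * (suc n C suc k)                        ∎

  centralBinomial : ℕ → ℕ
  centralBinomial k = (2 * k) C k

  2[1+n]≡2+n+n : ∀ n → 2 * suc n ≡ suc (suc n + n)
  2[1+n]≡2+n+n = identity
    where
    identity : ∀ n → 2 * (1 + n) ≡ 1 + (1 + n + n)
    identity = solve-∀

  C[2n+1,n]-symmetric : ∀ n → (suc n + n) C n ≡ (suc n + n) C suc n
  C[2n+1,n]-symmetric n = trans
    (nCk≡nC[n∸k] (ℕ.m≤n+m n (suc n)))
    (cong ((suc n + n) C_) (ℕ.m+n∸n≡m (suc n) n))

  -- For n + 1 = p^a the right-hand side exhibits the factor p^a on which all later divisibility
  -- rests.
  centralBinomial-absorption : ∀ n → (1 + 2 * n) * centralBinomial n ≡ suc n * ((suc n + n) C n)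
  centralBinomial-absorption n = begin
    (1 + 2 * n) * centralBinomial n     ≡⟨ absorption (2 * n) n ⟨
    suc n * (suc (2 * n) C suc n)       ≡⟨ cong (λ z → suc n * (suc (n + z) C suc n)) (ℕ.+-identityʳ n) ⟩
    suc n * ((suc n + n) C suc n)       ≡⟨ cong (suc n *_) (C[2n+1,n]-symmetric n) ⟨
    suc n * ((suc n + n) C n)           ∎

  -- By Pascal's rule C(2n+2, n+1) is the sum of the two middle entries of row 2n+1, which are
  -- equal.
  centralBinomial-suc : ∀ n →
    suc n * centralBinomial (suc n) ≡ 2 * ((1 + 2 * n) * centralBinomial n)
  centralBinomial-suc n = begin
    suc n * ((2 * suc n) C suc n)                 ≡⟨ cong (λ z → suc n * (z C suc n)) (2[1+n]≡2+n+n n) ⟩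
    suc n * (suc (suc n + n) C suc n)             ≡⟨ cong (suc n *_) (nCk+nC[k+1]≡[n+1]C[k+1] (suc n + n) n) ⟨
    suc n * (X + ((suc n + n) C suc n))           ≡⟨ cong (λ z → suc n * (X + z)) (C[2n+1,n]-symmetric n) ⟨
    suc n * (X + X)                               ≡⟨ double (suc n) X ⟩
    2 * (suc n * X)                               ≡⟨ cong (2 *_) (centralBinomial-absorption n) ⟨
    2 * ((1 + 2 * n) * centralBinomial n)         ∎
    where
    X = (suc n + n) C n
    double : ∀ m x → m * (x + x) ≡ 2 * (m * x)
    double = solve-∀

  -- The coefficients A_j and their closed form.

  -- coeff n j = ∑_{k<n} 4^(n-1-k) C(2k,k) C(k,j).
  coeff : ℕ → ℕ → ℕ
  coeff zero    j = 0
  coeff (suc n) j = 4 * coeff n j + centralBinomial n * (n C j)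

  -- Induction on `n`: `centralBinomial-suc` turns C(2n, n) in the hypothesis into C(2n+2, n+1),
  -- `lowering` turns C(n, j) into C(n+1, j), and the two summands merge into one product.
  coeff-closed : ∀ n j →
    (1 + 2 * j) * coeff (suc n) j ≡ ((1 + 2 * n) * centralBinomial n) * (n C j)
  coeff-closed zero zero = refl
  coeff-closed zero (suc j) = begin
    (1 + 2 * suc j) * coeff 1 (suc j)  ≡⟨ cong (λ z → (1 + 2 * suc j) * (1 * z)) (k>n⇒nCk≡0 {0} {suc j} (s≤s z≤n)) ⟩
    (1 + 2 * suc j) * 0                ≡⟨ ℕ.*-zeroʳ (1 + 2 * suc j) ⟩
    0                                  ≡⟨ cong (1 *_) (k>n⇒nCk≡0 {0} {suc j} (s≤s z≤n)) ⟨
    1 * (0 C suc j)                    ∎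
  coeff-closed (suc n) j = begin
    (1 + 2 * j) * (4 * coeff (suc n) j + b′ * c′)
      ≡⟨ expand j (coeff (suc n) j) b′ c′ ⟩
    4 * ((1 + 2 * j) * coeff (suc n) j) + (1 + 2 * j) * (b′ * c′)
      ≡⟨ cong (λ z → 4 * z + (1 + 2 * j) * (b′ * c′)) (coeff-closed n j) ⟩
    4 * ((1 + 2 * n) * b * c) + (1 + 2 * j) * (b′ * c′)
      ≡⟨ cong (_+ (1 + 2 * j) * (b′ * c′)) (regroup ((1 + 2 * n) * b) c) ⟩
    2 * (2 * ((1 + 2 * n) * b)) * c + (1 + 2 * j) * (b′ * c′)
      ≡⟨ cong (λ z → 2 * z * c + (1 + 2 * j) * (b′ * c′)) (centralBinomial-suc n) ⟨
    2 * (suc n * b′) * c + (1 + 2 * j) * (b′ * c′)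
      ≡⟨ collect n j b′ c c′ ⟩
    b′ * (2 * (suc n * c + j * c′) + c′)
      ≡⟨ cong (λ z → b′ * (2 * z + c′)) (lowering n j) ⟩
    b′ * (2 * (suc n * c′) + c′)
      ≡⟨ finish (suc n) b′ c′ ⟩
    ((1 + 2 * suc n) * b′) * c′ ∎
    where
    b  = centralBinomial n
    b′ = centralBinomial (suc n)
    c  = n C j
    c′ = suc n C j
    expand : ∀ j a b c → (1 + 2 * j) * (4 * a + b * c) ≡ 4 * ((1 + 2 * j) * a) + (1 + 2 * j) * (b * c)
    expand = solve-∀
    regroup : ∀ m c → 4 * (m * c) ≡ 2 * (2 * m) * c
    regroup = solve-∀
    collect : ∀ n j b c d → 2 * ((1 + n) * b) * c + (1 + 2 * j) * (b * d) ≡ b * (2 * ((1 + n) * c + j * d) + d)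
    collect = solve-∀
    finish : ∀ m b c → b * (2 * (m * c) + c) ≡ ((1 + 2 * m) * b) * c
    finish = solve-∀

  -- Cancellation and growth of prime powers.

  -- Euclid's lemma finds one factor p in `v`; cancelling it on both sides lowers the exponent by
  -- one.
  prime-power-cancel : ∀ {p} → Prime p → ∀ a u {v} → ¬ p ∣ u → p ^ a ∣ u * v → p ^ a ∣ v
  prime-power-cancel pp zero u p∤u _ = 1∣ _
  prime-power-cancel {p} pp (suc a) u {v} p∤u d with euclidsLemma u v pp (∣-trans (m∣m*n (p ^ a)) d)
  ... | inj₁ p∣u = contradiction p∣u p∤u
  ... | inj₂ (divides-refl w) =
    subst (p ^ suc a ∣_) (ℕ.*-comm p w)
      (*-monoʳ-∣ p (prime-power-cancel pp a u p∤u (*-cancelˡ-∣ p (subst (p * p ^ a ∣_) (swap u w p) d))))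
    where
    instance
      _ = prime⇒nonZero pp
    swap : ∀ u w p → u * (w * p) ≡ p * (u * w)
    swap = solve-∀

  -- As m < p ^ j, the p-adic valuation of m is less than j.  Each factor
  -- p of m is absorbed by a factor of p ^ j, leaving at least one.
  power-dominates : ∀ {p} → Prime p → ∀ a j m {x} → m ℕ.> 0 → m < p ^ j →
                    p ^ a ∣ m * x → p ^ suc a ∣ p ^ j * x
  power-dominates pp a zero m m>0 m<1 d = contradiction m<1 (ℕ.≤⇒≯ m>0)
  power-dominates {p} pp a (suc j) m {x} m>0 m<p^j d with p ∣? m
  ... | no p∤m =
    subst (p * p ^ a ∣_) (sym (ℕ.*-assoc p (p ^ j) x))
      (*-monoʳ-∣ p (∣n⇒∣m*n (p ^ j) (prime-power-cancel pp a m p∤m d)))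
  ... | yes (divides-refl zero) = contradiction m>0 (ℕ.n≮n 0)
  ... | yes (divides-refl m′@(suc _)) =
    subst (p ^ suc a ∣_) (left (p ^ j) p x)
      (power-dominates pp a j m′ {p * x} (s≤s z≤n)
        (ℕ.*-cancelˡ-< p m′ (p ^ j) (subst (_< p * p ^ j) (ℕ.*-comm m′ p) m<p^j))
        (subst (p ^ a ∣_) (ℕ.*-assoc m′ p x) d))
    where
    left : ∀ q p x → q * (p * x) ≡ p * q * x
    left = solve-∀

  -- The base case is 3 < p, which fails for p = 3. After that the right side grows by a factor of
  -- at least 4, the left only by 2.
  1+2[1+j]<p^[1+j] : ∀ {p} → p > 3 → ∀ j → 1 + 2 * suc j < p ^ suc j
  1+2[1+j]<p^[1+j] {p} p>3 zero = subst (3 <_) (sym (ℕ.*-identityʳ p)) p>3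
  1+2[1+j]<p^[1+j] {p} p>3 (suc j) =
    ℕ.≤-trans (ℕ.m+n≤o⇒m≤o _ (ℕ.≤-reflexive (slack j))) (ℕ.*-mono-≤ p>3 (1+2[1+j]<p^[1+j] p>3 j))
    where
    -- The surplus `10 + 6 * j` is four times the old successor `2 + 2 * (1 + j)` minus the new one.
    slack : ∀ j → 2 + 2 * (2 + j) + (10 + 6 * j) ≡ 4 * (2 + 2 * (1 + j))
    slack = solve-∀

  -- Binomial coefficients modulo p.

  -- By absorption p^a divides k C(p^a, k). If p did not divide the binomial coefficient, p^a would
  -- divide k, although 0 < k < p^a.
  prime∣C : ∀ {p} → Prime p → ∀ a {k} → k > 0 → k < p ^ a → p ∣ (p ^ a) C k
  prime∣C {p} pp a {suc k} _ k<q with p ∣? (p ^ a) C suc k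
  ... | yes d = d
  ... | no p∤C = contradiction (∣⇒≤ (prime-power-cancel pp a _ p∤C q∣)) (ℕ.<⇒≱ k<q)
    where
    -- Generalised to any positive `q`, so that it can be matched as a successor, which `p ^ a`
    -- cannot.
    absorbed : ∀ {q} → q > 0 → q ∣ (q C suc k) * suc k
    absorbed {suc q} _ = divides (q C k)
      (trans (ℕ.*-comm _ (suc k)) (trans (absorption q k) (ℕ.*-comm (suc q) _)))
    q∣ = absorbed (ℕ.≤-trans (s≤s z≤n) k<q)

  -- The coefficient of x^k in (1 + x)^(q + m) ≡ (1 + x^q) (1 + x)^m.
  C-shift : ∀ {p} → Prime p → ∀ a m k → k < p ^ a → ∃ λ t → (p ^ a + m) C k ≡ (m C k) + t * p
  C-shift pp a zero zero k<q = 0 , refl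
  C-shift {p} pp a zero (suc k) k<q with prime∣C pp a (s≤s z≤n) k<q
  ... | divides t eq = t , (begin
    (p ^ a + 0) C suc k      ≡⟨ cong (_C suc k) (ℕ.+-identityʳ (p ^ a)) ⟩
    (p ^ a) C suc k          ≡⟨ eq ⟩
    t * p                    ≡⟨ cong (_+ t * p) (k>n⇒nCk≡0 {0} {suc k} (s≤s z≤n)) ⟨
    (0 C suc k) + t * p      ∎)
  C-shift pp a (suc m) zero k<q = 0 , refl
  C-shift {p} pp a (suc m) (suc k) k<q with C-shift pp a m k (ℕ.<-trans (ℕ.n<1+n k) k<q) | C-shift pp a m (suc k) k<q
  ... | s , eq₁ | t , eq₂ = s + t , (begin
    (p ^ a + suc m) C suc k                        ≡⟨ cong (_C suc k) (ℕ.+-suc (p ^ a) m) ⟩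
    suc (p ^ a + m) C suc k                        ≡⟨ nCk+nC[k+1]≡[n+1]C[k+1] (p ^ a + m) k ⟨
    ((p ^ a + m) C k) + ((p ^ a + m) C suc k)      ≡⟨ cong₂ _+_ eq₁ eq₂ ⟩
    (m C k) + s * p + ((m C suc k) + t * p)        ≡⟨ collect (m C k) s p (m C suc k) t ⟩
    (m C k) + (m C suc k) + (s + t) * p            ≡⟨ cong (_+ (s + t) * p) (nCk+nC[k+1]≡[n+1]C[k+1] m k) ⟩
    (suc m C suc k) + (s + t) * p                  ∎)
    where
    collect : ∀ x s p y t → x + s * p + (y + t * p) ≡ x + y + (s + t) * p
    collect = solve-∀

  -- The coefficients A_j for q = p^a.

  module _ {p} (pp : Prime p) (a : ℕ) {N} (q≡ : p ^ a ≡ suc N) where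

    private
      c : ℕ
      c = (suc N + N) C N

    -- The factor `suc N` produced by `centralBinomial-absorption` is p^a itself, and `c` is C(2q-1,
    -- q-1).
    coeff-at-power : ∀ j → (1 + 2 * j) * coeff (p ^ a) j ≡ (p ^ a * c) * (N C j)
    coeff-at-power j rewrite q≡ =
      trans (coeff-closed N j) (cong (_* (N C j)) (centralBinomial-absorption N))

    -- `C-shift` gives C(q+N, N) ≡ C(N, N) = 1 mod p, and the outer factor p^a lifts this to modulus
    -- p^(a+1).
    coeff-0-mod : ∃ λ t → coeff (p ^ a) 0 ≡ p ^ a + t * p ^ suc a
    coeff-0-mod with C-shift pp a N N (subst (N <_) (sym q≡) (ℕ.n<1+n N))
    ... | t , eq = t , (begin
      coeff (p ^ a) 0            ≡⟨ ℕ.*-identityˡ _ ⟨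
      1 * coeff (p ^ a) 0        ≡⟨ coeff-at-power 0 ⟩
      p ^ a * c * 1              ≡⟨ ℕ.*-identityʳ _ ⟩
      p ^ a * c                  ≡⟨ cong (λ q → p ^ a * ((q + N) C N)) q≡ ⟨
      p ^ a * ((p ^ a + N) C N)  ≡⟨ cong (p ^ a *_) eq ⟩
      p ^ a * ((N C N) + t * p)  ≡⟨ cong (λ z → p ^ a * (z + t * p)) (nCn≡1 N) ⟩
      p ^ a * (1 + t * p)        ≡⟨ expand (p ^ a) t p ⟩
      p ^ a + t * p ^ suc a      ∎)
      where
      expand : ∀ q t p → q * (1 + t * p) ≡ q + t * (p * q)
      expand = solve-∀

    -- Here p^(j+1) stands in for y^(j+1), which it divides. It outweighs the odd factor that
    -- `coeff-at-power` puts in front of the coefficient.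
    coeff-suc-divisible : p > 3 → ∀ j → p ^ suc a ∣ p ^ suc j * coeff (p ^ a) (suc j)
    coeff-suc-divisible p>3 j =
      power-dominates pp a (suc j) (1 + 2 * suc j) (s≤s z≤n) (1+2[1+j]<p^[1+j] p>3 j)
        (subst (p ^ a ∣_) (sym (coeff-at-power (suc j)))
          (∣m⇒∣m*n (N C suc j) (m∣m*n c)))

  -- Primes above 3 and the number 2.

  prime>3⇒∤2 : ∀ {p} → p > 3 → ¬ p ∣ 2
  prime>3⇒∤2 p>3 d = ℕ.≤⇒≯ (∣⇒≤ d) (ℕ.<-trans (ℕ.n<1+n 2) p>3)

  prime>3⇒∤4 : ∀ {p} → Prime p → p > 3 → ¬ p ∣ 4
  prime>3⇒∤4 pp p>3 d with euclidsLemma 2 2 pp d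
  ... | inj₁ d′ = prime>3⇒∤2 p>3 d′
  ... | inj₂ d′ = prime>3⇒∤2 p>3 d′

  prime>3⇒odd : ∀ {p} → Prime p → p > 3 → ∃ λ h → p ≡ 1 + h * 2
  prime>3⇒odd {p} pp p>3 =
    p / 2 , trans (m≡m%n+[m/n]*n p 2) (cong (_+ (p / 2) * 2) (p%2≡1 (m%n<n p 2) refl))
    where
    p%2≢0 : p % 2 ≢ 0
    p%2≢0 r≡0 with prime⇒irreducible pp (m%n≡0⇒n∣m p 2 r≡0)
    ... | inj₂ 2≡p = contradiction (subst (_> 3) (sym 2≡p) p>3) λ { (s≤s (s≤s ())) }
    p%2≡1 : ∀ {r} → r < 2 → p % 2 ≡ r → r ≡ 1
    p%2≡1 {0} _ r≡0 = contradiction r≡0 p%2≢0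
    p%2≡1 {1} _ _   = refl
    p%2≡1 {suc (suc _)} (s≤s (s≤s ())) _

open Naturals
open import Data.Integer.Base using (ℤ; +_; 0ℤ; 1ℤ; -1ℤ; -_; _+_; _-_; _*_; _^_; ∣_∣)
open import Data.Integer.Divisibility.Signed
import Data.Integer.Properties as ℤ
open import Data.Integer.Tactic.RingSolver using (solve-∀)
import Data.Nat.Divisibility as ℕ
open import Algebra.Properties.CommutativeMonoid.Sum ℤ.+-0-commutativeMonoid
  using (∑-distrib-+; sum-cong-≗; sum-init-last; sum-replicate-zero)
open import Algebra.Properties.Semiring.Sum ℤ.+-*-semiring using (*-distribˡ-sum)
open ≡-Reasoning

-- Finite sums of integers.

∑-cong : ∀ n {f g : ℕ → ℤ} → (∀ k → f k ≡ g k) → ∑[ k < n ] f (toℕ k) ≡ ∑[ k < n ] g (toℕ k)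
∑-cong n f≗g = sum-cong-≗ {n} (λ k → f≗g (toℕ k))

∑-snoc : ∀ n (f : ℕ → ℤ) → ∑[ k < suc n ] f (toℕ k) ≡ ∑[ k < n ] f (toℕ k) + f n
∑-snoc n f = begin
  ∑[ k < suc n ] f (toℕ k)                                 ≡⟨ sum-init-last {n} (λ k → f (toℕ k)) ⟩
  ∑[ k < n ] f (toℕ (inject₁ k)) + f (toℕ (fromℕ n))       ≡⟨ cong₂ _+_ (sum-cong-≗ {n} (λ k → cong f (toℕ-inject₁ k)))
                                                                       (cong f (toℕ-fromℕ n)) ⟩
  ∑[ k < n ] f (toℕ k) + f n                               ∎

∑-linear : ∀ n c d (f g : ℕ → ℤ) →
           c * ∑[ k < n ] f (toℕ k) + d * ∑[ k < n ] g (toℕ k) ≡ ∑[ k < n ] (c * f (toℕ k) + d * g (toℕ k))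
∑-linear n c d f g = begin
  c * ∑[ k < n ] f (toℕ k) + d * ∑[ k < n ] g (toℕ k)
    ≡⟨ cong₂ _+_ (*-distribˡ-sum {n} c (λ k → f (toℕ k))) (*-distribˡ-sum {n} d (λ k → g (toℕ k))) ⟩
  ∑[ k < n ] (c * f (toℕ k)) + ∑[ k < n ] (d * g (toℕ k))
    ≡⟨ ∑-distrib-+ {n} (λ k → c * f (toℕ k)) (λ k → d * g (toℕ k)) ⟨
  ∑[ k < n ] (c * f (toℕ k) + d * g (toℕ k)) ∎

-- The bound k < n matters for `freshman`, where divisibility by p holds only strictly between the
-- two ends of the row.
∑-mod-head : ∀ {m} n (f : ℕ → ℤ) → (∀ k → k ℕ.< n → m ∣ f (suc k)) →
             ∑[ k < suc n ] f (toℕ k) ≡ f 0 [mod m ]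
∑-mod-head {m} zero f _ = divides 0ℤ (cancel (f 0))
  where
  cancel : ∀ x → x + 0ℤ - x ≡ 0ℤ
  cancel = solve-∀
∑-mod-head {m} (suc n) f m∣f =
  subst (λ s → m ∣ s - f 0) (sym (∑-snoc (suc n) f))
    (subst (m ∣_) (move (∑[ k < suc n ] f (toℕ k)) (f 0) (f (suc n)))
      (∣m∣n⇒∣m+n (∑-mod-head n f (λ k k<n → m∣f k (ℕ.<-trans k<n (ℕ.n<1+n n)))) (m∣f n (ℕ.n<1+n n))))
  where
  move : ∀ s x y → s - x + y ≡ s + y - x
  move = solve-∀

-- Expansion in powers of y.

-- The upper limit is left free so that expansions of different degrees can be
-- added termwise.
binomial-theorem : ∀ y n {N} → n ℕ.< N → (1ℤ + y) ^ n ≡ ∑[ k < N ] (+ (n C toℕ k) * y ^ toℕ k)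
binomial-theorem y zero {suc N} _ = begin
  1ℤ + 0ℤ                                           ≡⟨ cong (_+_ 1ℤ) (sum-replicate-zero N) ⟨
  1ℤ + ∑[ k < N ] 0ℤ                                ≡⟨ cong (_+_ 1ℤ) (∑-cong N {λ _ → 0ℤ} {λ k → + (0 C suc k) * y ^ suc k} vanish) ⟩
  1ℤ + ∑[ k < N ] (+ (0 C suc (toℕ k)) * y ^ suc (toℕ k)) ∎
  where
  vanish : ∀ k → 0ℤ ≡ + (0 C suc k) * y ^ suc k
  vanish k = sym (trans (cong (λ c → + c * y ^ suc k) (k>n⇒nCk≡0 {0} {suc k} (s≤s z≤n))) (ℤ.*-zeroˡ (y ^ suc k)))
binomial-theorem y (suc n) {suc N} n<N = begin
  (1ℤ + y) * (1ℤ + y) ^ n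
    ≡⟨ expand y ((1ℤ + y) ^ n) ⟩
  (1ℤ + y) ^ n + y * (1ℤ + y) ^ n
    -- The first copy runs to `suc N` and unfolds to 1 + `T`; the second stops at `N`, so that y
    -- times its k-th term meets the k-th term of `T`.
    ≡⟨ cong₂ (λ s t → s + y * t) (binomial-theorem y n (ℕ.<-trans (s<s⁻¹ n<N) (ℕ.n<1+n N))) (binomial-theorem y n (s<s⁻¹ n<N)) ⟩
  1ℤ + T + y * ∑[ k < N ] f (toℕ k)
    ≡⟨ shift T (y * ∑[ k < N ] f (toℕ k)) ⟩
  1ℤ + (y * ∑[ k < N ] f (toℕ k) + 1ℤ * T)
    ≡⟨ cong (_+_ 1ℤ) (∑-linear N y 1ℤ f (λ k → f (suc k))) ⟩
  1ℤ + ∑[ k < N ] (y * f (toℕ k) + 1ℤ * f (suc (toℕ k)))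
    ≡⟨ cong (_+_ 1ℤ) (∑-cong N pascal) ⟩
  1ℤ + ∑[ k < N ] (+ (suc n C suc (toℕ k)) * y ^ suc (toℕ k)) ∎
  where
  f : ℕ → ℤ
  f k = + (n C k) * y ^ k
  T : ℤ
  T = ∑[ k < N ] f (suc (toℕ k))
  expand : ∀ y z → (1ℤ + y) * z ≡ z + y * z
  expand = solve-∀
  shift : ∀ t u → 1ℤ + t + u ≡ 1ℤ + (u + 1ℤ * t)
  shift = solve-∀
  factor : ∀ y a b z → y * (a * z) + 1ℤ * (b * (y * z)) ≡ (a + b) * (y * z)
  factor = solve-∀
  pascal : ∀ k → y * f k + 1ℤ * f (suc k) ≡ + (suc n C suc k) * y ^ suc k
  pascal k = trans (factor y (+ (n C k)) (+ (n C suc k)) (y ^ k))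
    (cong (λ c → c * y ^ suc k)
      (trans (sym (ℤ.pos-+ (n C k) (n C suc k))) (cong (λ c → + c) (nCk+nC[k+1]≡[n+1]C[k+1] n k))))

^-distribʳ-* : ∀ x y n → (x * y) ^ n ≡ x ^ n * y ^ n
^-distribʳ-* x y zero    = refl
^-distribʳ-* x y (suc n) = trans (cong (x * y *_) (^-distribʳ-* x y n)) (swap x y (x ^ n) (y ^ n))
  where
  swap : ∀ x y u v → x * y * (u * v) ≡ x * u * (y * v)
  swap = solve-∀

-- The factor 4^n turns the newest power x^n into (1 + y)^n, and the recursion of `coeff` collects
-- the powers of y. A factor 4 remains on the right because `coeff` carries 4^(n-1-k).
∑-expansion : ∀ {x y} → x * + 4 ≡ 1ℤ + y → ∀ n {N} → n ℕ.≤ N →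
              (+ 4) ^ n * ∑[ k < n ] (+ centralBinomial (toℕ k) * x ^ toℕ k)
              ≡ + 4 * ∑[ j < N ] (+ coeff n (toℕ j) * y ^ toℕ j)
∑-expansion {x} {y} 4x≡1+y zero {N} _ = sym (cong (+ 4 *_) (begin
  ∑[ j < N ] (0ℤ * y ^ toℕ j)  ≡⟨ ∑-cong N {λ j → 0ℤ * y ^ j} (λ j → ℤ.*-zeroˡ (y ^ j)) ⟩
  ∑[ j < N ] 0ℤ                ≡⟨ sum-replicate-zero N ⟩
  0ℤ                           ∎))
∑-expansion {x} {y} 4x≡1+y (suc n) {N} n<N = begin
  (+ 4) ^ suc n * ∑[ k < suc n ] f (toℕ k)
    ≡⟨ cong ((+ 4) ^ suc n *_) (∑-snoc n f) ⟩
  (+ 4) ^ suc n * (∑[ k < n ] f (toℕ k) + f n)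
    ≡⟨ expand ((+ 4) ^ n) (∑[ k < n ] f (toℕ k)) b (x ^ n) ⟩
  + 4 * ((+ 4) ^ n * ∑[ k < n ] f (toℕ k) + b * (x ^ n * (+ 4) ^ n))
    ≡⟨ cong₂ (λ s t → + 4 * (s + b * t)) (∑-expansion 4x≡1+y n (ℕ.<⇒≤ n<N)) power ⟩
  + 4 * (+ 4 * ∑[ j < N ] g (toℕ j) + b * ∑[ j < N ] h (toℕ j))
    ≡⟨ cong (+ 4 *_) (∑-linear N (+ 4) b g h) ⟩
  + 4 * ∑[ j < N ] (+ 4 * g (toℕ j) + b * h (toℕ j))
    ≡⟨ cong (+ 4 *_) (∑-cong N recurrence) ⟩
  + 4 * ∑[ j < N ] (+ coeff (suc n) (toℕ j) * y ^ toℕ j) ∎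
  where
  b : ℤ
  b = + centralBinomial n
  f g h : ℕ → ℤ
  f k = + centralBinomial k * x ^ k
  g j = + coeff n j * y ^ j
  h j = + (n C j) * y ^ j
  expand : ∀ q s b z → + 4 * q * (s + b * z) ≡ + 4 * (q * s + b * (z * q))
  expand = solve-∀
  power : x ^ n * (+ 4) ^ n ≡ ∑[ j < N ] h (toℕ j)
  power = begin
    x ^ n * (+ 4) ^ n       ≡⟨ ^-distribʳ-* x (+ 4) n ⟨
    (x * + 4) ^ n         ≡⟨ cong (_^ n) 4x≡1+y ⟩
    (1ℤ + y) ^ n          ≡⟨ binomial-theorem y n n<N ⟩
    ∑[ j < N ] h (toℕ j)  ∎
  factor : ∀ a b c z → + 4 * (a * z) + b * (c * z) ≡ (+ 4 * a + b * c) * z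
  factor = solve-∀
  recurrence : ∀ j → + 4 * g j + b * h j ≡ + coeff (suc n) j * y ^ j
  recurrence j = trans (factor (+ coeff n j) b (+ (n C j)) (y ^ j)) (cong (_* y ^ j) (sym (begin
    + (4 ℕ.* coeff n j ℕ.+ centralBinomial n ℕ.* (n C j))
      ≡⟨ ℤ.pos-+ (4 ℕ.* coeff n j) _ ⟩
    + (4 ℕ.* coeff n j) + + (centralBinomial n ℕ.* (n C j))
      ≡⟨ cong₂ _+_ (ℤ.pos-* 4 (coeff n j)) (ℤ.pos-* (centralBinomial n) (n C j)) ⟩
    + 4 * + coeff n j + b * + (n C j) ∎)))

-- Congruences modulo p and cancellation over the integers.

freshman : ∀ {p} → Prime p → ∀ a y → (1ℤ + y) ^ (p ℕ.^ a) ≡ 1ℤ + y ^ (p ℕ.^ a) [mod + p ]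
freshman {p} pp a y with p ℕ.^ a in q≡
... | zero  = contradiction (ℕ.m^n≡0⇒m≡0 p a q≡) (ℕ.≢-nonZero⁻¹ p {{prime⇒nonZero pp}})
... | suc N = subst (+ p ∣_) (sym difference) (∑-mod-head N f divisible)
  where
  q : ℕ
  q = suc N
  f : ℕ → ℤ
  f k = + (q C k) * y ^ k
  divisible : ∀ k → k ℕ.< N → + p ∣ f (suc k)
  divisible k k<N = ∣m⇒∣m*n {m = + (q C suc k)} (y ^ suc k) (∣ᵤ⇒∣
    (subst (λ q → p ℕ.∣ q C suc k) q≡ (prime∣C pp a (s≤s z≤n) (subst (suc k ℕ.<_) (sym q≡) (s≤s k<N)))))
  cancel : ∀ s z → s + 1ℤ * z - (1ℤ + z) ≡ s - 1ℤ
  cancel = solve-∀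
  -- The top term k = q cancels y^q; the remaining terms have head 1 and a tail divisible by p.
  difference : (1ℤ + y) ^ q - (1ℤ + y ^ q) ≡ ∑[ k < q ] f (toℕ k) - 1ℤ
  difference = begin
    (1ℤ + y) ^ q - (1ℤ + y ^ q)
      ≡⟨ cong (_- (1ℤ + y ^ q)) (trans (binomial-theorem y q (ℕ.n<1+n q)) (∑-snoc q f)) ⟩
    ∑[ k < q ] f (toℕ k) + + (q C q) * y ^ q - (1ℤ + y ^ q)
      ≡⟨ cong (λ c → ∑[ k < q ] f (toℕ k) + + c * y ^ q - (1ℤ + y ^ q)) (nCn≡1 q) ⟩
    ∑[ k < q ] f (toℕ k) + 1ℤ * y ^ q - (1ℤ + y ^ q)
      ≡⟨ cancel (∑[ k < q ] f (toℕ k)) (y ^ q) ⟩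
    ∑[ k < q ] f (toℕ k) - 1ℤ ∎

-- `freshman` at y = 1 gives 2^q ≡ 2, and 2^q - 2 is a factor of 4^q - 4.
4^q≡4 : ∀ {p} → Prime p → ∀ a → (+ 4) ^ (p ℕ.^ a) ≡ + 4 [mod + p ]
4^q≡4 {p} pp a = subst (+ p ∣_) square (∣n⇒∣m*n ((+ 2) ^ q + + 2) 2^q≡2)
  where
  q : ℕ
  q = p ℕ.^ a
  2^q≡2 : (+ 2) ^ q ≡ + 2 [mod + p ]
  2^q≡2 = subst (λ z → (+ 2) ^ q ≡ 1ℤ + z [mod + p ]) (ℤ.^-zeroˡ q) (freshman pp a 1ℤ)
  expand : ∀ z → (z + + 2) * (z - + 2) ≡ z * z - + 4
  expand = solve-∀
  square : ((+ 2) ^ q + + 2) * ((+ 2) ^ q - + 2) ≡ (+ 4) ^ q - + 4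
  square = trans (expand ((+ 2) ^ q)) (cong (_- + 4) (sym (^-distribʳ-* (+ 2) (+ 2) q)))

∣-^ : ∀ {p x} → + p ∣ x → ∀ n → + (p ℕ.^ n) ∣ x ^ n
∣-^ p∣x zero = ∣-refl
∣-^ {p} {x} p∣x (suc n) =
  subst (_∣ x ^ suc n) (sym (ℤ.pos-* p (p ℕ.^ n)))
    (∣-trans (*-monoʳ-∣ (+ p) (∣-^ p∣x n)) (*-monoˡ-∣ (x ^ n) p∣x))

-- Removes one factor `x` at a time, passing to absolute values to use the cancellation over the
-- naturals.
prime-power-cancel-^ : ∀ {p} → Prime p → ∀ a x {y} → ¬ p ℕ.∣ ∣ x ∣ → ∀ n →
                       + (p ℕ.^ a) ∣ x ^ n * y → + (p ℕ.^ a) ∣ y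
prime-power-cancel-^ pp a x {y} p∤x zero d = subst (+ _ ∣_) (ℤ.*-identityˡ y) d
prime-power-cancel-^ {p} pp a x {y} p∤x (suc n) d =
  prime-power-cancel-^ pp a x p∤x n (∣ᵤ⇒∣ (prime-power-cancel pp a ∣ x ∣ p∤x
    (subst (p ℕ.^ a ℕ.∣_) (trans (cong ∣_∣ (ℤ.*-assoc x (x ^ n) y)) (ℤ.abs-* x (x ^ n * y))) (∣⇒∣ᵤ d))))

-- The congruence for general x and y with 4x = 1 + y and p dividing y.

module _ {p} (pp : Prime p) (p>3 : p ℕ.> 3) (a : ℕ)
         {x y : ℤ} (4x≡1+y : x * + 4 ≡ 1ℤ + y) (p∣y : + p ∣ y) where

  private
    q pq : ℕ
    q  = p ℕ.^ a
    pq = p ℕ.^ suc a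
    S : ℤ
    S = ∑[ k < q ] (+ centralBinomial (toℕ k) * x ^ toℕ k)
    f : ℕ → ℤ
    f j = + coeff q j * y ^ j

  expansion≡q : ∑[ j < q ] f (toℕ j) ≡ + q [mod + pq ]
  expansion≡q = go refl
    where
    -- Only the upper limit becomes `r`, to be matched as a successor; `q` inside `f` keeps its form
    -- p^a.
    go : ∀ {r} → q ≡ r → ∑[ j < r ] f (toℕ j) ≡ + q [mod + pq ]
    go {zero}  q≡0 = contradiction (ℕ.m^n≡0⇒m≡0 p a q≡0) (ℕ.≢-nonZero⁻¹ p {{prime⇒nonZero pp}})
    go {suc N} q≡ with coeff-0-mod pp a q≡
    ... | t , eq = subst (+ pq ∣_) (telescope (∑[ j < suc N ] f (toℕ j)) (f 0) (+ q))
      (∣m∣n⇒∣m+n (∑-mod-head N f (λ j _ → tail j)) (divides (+ t) head))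
      where
      telescope : ∀ s u v → s - u + (u - v) ≡ s - v
      telescope = solve-∀
      cancel : ∀ u v → (u + v) * 1ℤ - u ≡ v
      cancel = solve-∀
      head : f 0 - + q ≡ + t * + pq
      head = begin
        + coeff q 0 * 1ℤ - + q            ≡⟨ cong (λ z → + z * 1ℤ - + q) eq ⟩
        + (q ℕ.+ t ℕ.* pq) * 1ℤ - + q     ≡⟨ cong (λ z → z * 1ℤ - + q) (ℤ.pos-+ q (t ℕ.* pq)) ⟩
        (+ q + + (t ℕ.* pq)) * 1ℤ - + q   ≡⟨ cancel (+ q) (+ (t ℕ.* pq)) ⟩
        + (t ℕ.* pq)                      ≡⟨ ℤ.pos-* t pq ⟩
        + t * + pq                        ∎
      -- Since p^(j+1) divides y^(j+1), the multiple of pq from `coeff-suc-divisible` divides this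
      -- term.
      tail : ∀ j → + pq ∣ f (suc j)
      tail j = ∣-trans (∣ᵤ⇒∣ (coeff-suc-divisible pp a q≡ p>3 j))
        (subst (+ (p ℕ.^ suc j ℕ.* coeff q (suc j)) ∣_) (ℤ.*-comm (y ^ suc j) _)
          (subst (_∣ y ^ suc j * + coeff q (suc j)) (sym (ℤ.pos-* (p ℕ.^ suc j) (coeff q (suc j))))
            (*-monoˡ-∣ (+ coeff q (suc j)) (∣-^ p∣y (suc j)))))

  -- 4^q (S - q) = 4 (E - q) - (4^q - 4) q. Both terms on the right are multiples of pq, the second
  -- because p divides 4^q - 4. As p does not divide 4, the power 4^q cancels.
  ∑-centralBinomial : S ≡ + q [mod + pq ]
  ∑-centralBinomial = prime-power-cancel-^ pp (suc a) (+ 4) (prime>3⇒∤4 pp p>3) q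
    (subst (+ pq ∣_) (sym difference)
      (∣m∣n⇒∣m-n (∣n⇒∣m*n (+ 4) expansion≡q)
        (subst (_∣ ((+ 4) ^ q - + 4) * + q) (sym (ℤ.pos-* p q)) (*-monoˡ-∣ (+ q) (4^q≡4 pp a)))))
    where
    E : ℤ
    E = ∑[ j < q ] f (toℕ j)
    regroup : ∀ z e u → + 4 * e - z * u ≡ + 4 * (e - u) - (z - + 4) * u
    regroup = solve-∀
    distrib : ∀ z s u → z * (s - u) ≡ z * s - z * u
    distrib = solve-∀
    difference : (+ 4) ^ q * (S - + q) ≡ + 4 * (E - + q) - ((+ 4) ^ q - + 4) * + q
    difference = begin
      (+ 4) ^ q * (S - + q)                            ≡⟨ distrib ((+ 4) ^ q) S (+ q) ⟩
      (+ 4) ^ q * S - (+ 4) ^ q * + q                    ≡⟨ cong (_- (+ 4) ^ q * + q) (∑-expansion 4x≡1+y q ℕ.≤-refl) ⟩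
      + 4 * E - (+ 4) ^ q * + q                        ≡⟨ regroup ((+ 4) ^ q) E (+ q) ⟩
      + 4 * (E - + q) - ((+ 4) ^ q - + 4) * + q        ∎

corollary1p3 : ∀ (p a : ℕ) → Prime p → p ℕ.> 3 → a ℕ.> 0 →
    (∑[ k < p ℕ.^ a ] (+ ((2 ℕ.* toℕ k) C (toℕ k)) * base p ^ toℕ k))
    ≡ + (p ℕ.^ a) [mod + (p ℕ.^ (a ℕ.+ 1)) ]
corollary1p3 p a pp p>3 _ with prime>3⇒odd pp p>3
... | h , refl rewrite ℕ.+-comm a 1 =
  -- With y = -p*, the relation 4x = 1 + y is the exactness of the division in `base`, available
  -- since p = 1 + 2h.
  ∑-centralBinomial pp p>3 a {x = base p} {y = - signedPrime p} (base-exact h)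
    (∣m⇒∣-m (∣n⇒∣m*n (-1ℤ ^ ((p ℕ.∸ 1) ℕ./ 2)) ∣-refl))
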